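{- For every linear ordering $\mathcal{X} = (X, \leq)$, every graph on $X$ is an $\mathcal{X}$-rainbow threshold graph; that is, for every graph $\mathcal{G}$ with vertex set $X$ there are a set $K$ and a $K$-rainbow sequence $S$ on $X$ such that $\mathcal{G} = \mathcal{G}_{S,\leq}$.
   Context: Graphs are simple undirected graphs, and $\mathcal{P}(K)$ is the power set of $K$. For sets $K, X$ (possibly infinite), a $K$-rainbow sequence on $X$ is a pair $S=(a,e)$ of functions $a:X\to K$ and $e:X\to\mathcal{P}(K)$. Given a linear ordering $\mathcal{X}=(X,\leq)$ and a $K$-rainbow sequence $S=(a,e)$ on $X$, $\mathcal{G}_{S,\leq}$ is the graph on vertex set $X$ in which, for all $x<y$ in $X$, $x$ and $y$ are adjacent if and only if $a(x)\in e(y)$; it is called the $\mathcal{X}$-rainbow threshold graph associated with $S$ and $\mathcal{X}$. -}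

module Defs where

open import Level using (Level; _⊔_; suc)
open import Data.Product using (_×_; Σ-syntax; _,_; proj₂)
open import Data.Sum using (_⊎_; inj₁; inj₂; swap)
open import Relation.Binary.Core using (Rel; _⇔_)
open import Relation.Binary.Definitions using (Symmetric; Irreflexive)
open import Relation.Binary.PropositionalEquality using (_≡_; refl)
import Relation.Binary.Construct.NonStrictToStrict as ToStrict
open import Relation.Unary using (Pred; _∈_)

private
  variable
    x k ℓ g g′ p : Level

record Graph (X : Set x) (g : Level) : Set (x ⊔ suc g) where
  field
    Adj    : Rel X g
    sym    : Symmetric Adj
    irrefl : Irreflexive _≡_ Adj

open Graph public using (Adj)

-- Equality of graphs on the same vertex set is equality of edge sets, i.e.
-- adjacency in one is logically equivalent to adjacency in the other.
infix 4 _≈ᴳ_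
_≈ᴳ_ : {X : Set x} → Graph X g → Graph X g′ → Set (x ⊔ g ⊔ g′)
G ≈ᴳ H = Adj G ⇔ Adj H

-- The power set of K is the type of predicates Pred K p.
record RainbowSequence (K : Set k) (X : Set x) (p : Level) : Set (k ⊔ x ⊔ suc p) where
  field
    a : X → K
    e : X → Pred K p

-- The condition "for all u < v, u and v are adjacent iff a u ∈ e v" fixes
-- adjacency only on ordered pairs; it is symmetrised here.  The relation _<_
-- is u ≤ v together with ¬ (u ≡ v).
rainbowThresholdGraph : {K : Set k} {X : Set x} (_≤_ : Rel X ℓ) →
                        RainbowSequence K X p → Graph X (x ⊔ ℓ ⊔ p)
rainbowThresholdGraph {X = X} _≤_ S = record
  { Adj    = λ u v → (u < v × a u ∈ e v) ⊎ (v < u × a v ∈ e u)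
  ; sym    = swap
  ; irrefl = λ { refl (inj₁ (u<u , _)) → proj₂ u<u refl
               ; refl (inj₂ (u<u , _)) → proj₂ u<u refl }
  }
  where
  open RainbowSequence S
  open ToStrict _≡_ _≤_ using (_<_)

IsRainbowThresholdGraph : {X : Set x} (k p : Level) → Rel X ℓ → Graph X g →
                          Set (x ⊔ ℓ ⊔ g ⊔ suc k ⊔ suc p)
IsRainbowThresholdGraph {X = X} k p _≤_ G =
  Σ[ K ∈ Set k ] Σ[ S ∈ RainbowSequence K X p ] (G ≈ᴳ rainbowThresholdGraph _≤_ S)

{-# OPTIONS --safe #-}
module Submission where

open import Defs
open import Data.Product using (_,_)
open import Data.Sum using (inj₁; inj₂)
open import Function using (id; flip)
open import Level using (Level)
open import Relation.Binary.Core using (Rel)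
open import Relation.Binary.Structures using (IsTotalOrder)
open import Relation.Binary.PropositionalEquality using (_≡_)

-- Use the vertices as colours: each vertex is its own colour and accepts exactly its neighbours.
-- The rainbow condition on an ordered pair is then adjacency in `G` itself, so the order only
-- decides which endpoint is consulted.

neighbourhoods : ∀ {x g : Level} {X : Set x} → Graph X g → RainbowSequence X X g
-- With `flip`, `a u ∈ e v` unfolds to `Adj G u v`, so edges serve as membership proofs.
neighbourhoods G = record { a = id ; e = flip (Adj G) }

proposition2p7 : ∀ {x ℓ g : Level} (X : Set x) (_≤_ : Rel X ℓ) → IsTotalOrder _≡_ _≤_ →
    (G : Graph X g) → IsRainbowThresholdGraph x g _≤_ G
proposition2p7 X _≤_ isTotalOrder G = X , S , to , from
  where
  open IsTotalOrder isTotalOrder using (total)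
  open Graph G using (sym; irrefl)

  S = neighbourhoods G
  H = rainbowThresholdGraph _≤_ S

  to : ∀ {u v} → Adj G u v → Adj H u v
  to {u} {v} uv with total u v
  -- Totality gives only `≤`; it is strict because an edge between equal vertices would be a loop.
  ... | inj₁ u≤v = inj₁ ((u≤v , λ u≡v → irrefl u≡v uv) , uv)
  ... | inj₂ v≤u = inj₂ ((v≤u , λ v≡u → irrefl v≡u (sym uv)) , sym uv)

  from : ∀ {u v} → Adj H u v → Adj G u v
  from (inj₁ (_ , uv)) = uv
  from (inj₂ (_ , vu)) = sym vu
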